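{- Let $\mu$ be a probability measure on $\Omega$ with $\mu(\sigma)>0$ for all $\sigma\in\Omega$. If $D$ is atomic and $(D,\rho)$ regenerate $\mu$ at every flaw $f_i\in F$, then $(D,\rho,\mu)$ are harmonic. Moreover, for every $i\in[m]$ and every $\sigma\in f_i$, $$\sum_{\tau\in A(i,\sigma)}\mu(\tau)=\frac{\mu(\sigma)}{\mu(f_i)}.$$
   Context: $\Omega$ is a finite set of states and $F=\{f_1,\dots,f_m\}$ is a collection of non-empty subsets of $\Omega$ called flaws. For every $i\in[m]$ and $\sigma\in f_i$ a non-empty set $A(i,\sigma)\subseteq\Omega$, with $A(i,\sigma)\ne\{\sigma\}$, is given; $D$ is the multi-digraph on $\Omega$ having an arc $\sigma\xrightarrow{i}\tau$ for every $\sigma\in f_i$ and $\tau\in A(i,\sigma)$. For $\sigma\in f_i$, $\rho_i(\sigma,\cdot)$ is a probability distribution on $A(i,\sigma)$ (with $\rho_i(\sigma,\tau)=0$ for $\tau\notin A(i,\sigma)$). $D$ is atomic if $\max_{\tau\in\Omega}|\{\sigma\in f_i:\tau\in A(i,\sigma)\}|=1$ for every $i\in[m]$. $(D,\rho)$ regenerate $\mu$ at $f_i$ if $\frac{1}{\mu(f_i)}\sum_{\sigma\in f_i}\mu(\sigma)\rho_i(\sigma,\tau)=\mu(\tau)$ for every $\tau\in\Omega$. $(D,\rho,\mu)$ are harmonic if for every $i\in[m]$, $\sigma\in f_i$ and $\tau\in A(i,\sigma)$, $\rho_i(\sigma,\tau)=\mu(\tau)/\sum_{\sigma'\in A(i,\sigma)}\mu(\sigma')$.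 -}

module Defs where

open import Algebra.Apartness.Bundles using (HeytingField)
open import Algebra.Bundles using (CommutativeRing)
open import Data.Bool.Base using (true; false; if_then_else_)
open import Data.Fin.Base using (Fin; zero; suc)
open import Data.Fin.Subset using (Subset; Nonempty; ⁅_⁆; _∈_; _∉_; ∣_∣)
open import Data.Fin.Subset.Properties using (_∈?_)
open import Data.List.Base as List using ()
open import Data.List.Extrema.Nat using (max)
open import Data.Nat.Base using (ℕ; zero; suc)
open import Data.Product.Base using (_×_; _,_; proj₁)
open import Data.Sum.Base using (_⊎_; inj₁; inj₂)
open import Data.Vec.Base as Vec using ()
open import Data.Vec.Functional using (Vector)
open import Function.Bundles using (_⇔_; Equivalence)
open import Level using (_⊔_) renaming (suc to lsuc)
open import Relation.Binary.Core using (Rel)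
open import Relation.Binary.PropositionalEquality.Core using (_≡_; _≢_)
open import Relation.Binary.Structures using (IsStrictPartialOrder)
open import Relation.Nullary.Decidable.Core using (yes; no; does; _×-dec_)
open import Relation.Nullary.Negation.Core using (¬_; contradiction)

-- Stands in for ℝ, which the library lacks. Totality of the order is expressed
-- by #⇔<>, so both classical ordered fields (with # as ≉) and the constructive
-- reals qualify.
record OrderedField c ℓ₁ ℓ₂ ℓ₃ : Set (lsuc (c ⊔ ℓ₁ ⊔ ℓ₂ ⊔ ℓ₃)) where
  infix 4 _<_ _≤_
  infixl 7 _/_⟨_⟩
  field
    heytingField : HeytingField c ℓ₁ ℓ₂

  open HeytingField heytingField public

  field
    _<_                  : Rel Carrier ℓ₃
    isStrictPartialOrder : IsStrictPartialOrder _≈_ _<_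
    #⇔<>                 : ∀ {x y} → x # y ⇔ (x < y ⊎ y < x)
    +-monoˡ-<            : ∀ z {x y} → x < y → x + z < y + z
    *-pos                : ∀ {x y} → 0# < x → 0# < y → 0# < x * y

  open IsStrictPartialOrder isStrictPartialOrder public
    using (<-resp-≈; <-respʳ-≈; <-respˡ-≈)
    renaming (irrefl to <-irrefl; trans to <-trans; asym to <-asym)

  commutativeRing : CommutativeRing c ℓ₁
  commutativeRing = record { isCommutativeRing = isCommutativeRing }

  _≤_ : Rel Carrier ℓ₃
  x ≤ y = ¬ (y < x)

  pos⇒#0 : ∀ {x} → 0# < x → x # 0#
  pos⇒#0 0<x = Equivalence.from #⇔<> (inj₂ 0<x)

  -- #⇒invertible inverts y - 0#.
  _/_⟨_⟩ : (x y : Carrier) → y # 0# → Carrier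
  x / y ⟨ y#0 ⟩ = x * proj₁ (#⇒invertible y#0)

-- Flaws and arcs on the state space Ω = Fin n. The multi-digraph D has an arc
-- σ →ⁱ τ exactly when σ ∈ flaw i and τ ∈ A i σ. The sets A i σ with
-- σ ∉ flaw i are junk values, never consulted.
record FlawDigraph (n m : ℕ) : Set where
  field
    flaw          : Fin m → Subset n
    flaw-nonempty : ∀ i → Nonempty (flaw i)
    A             : Fin m → Fin n → Subset n
    A-nonempty    : ∀ i σ → σ ∈ flaw i → Nonempty (A i σ)
    A-nonloop     : ∀ i σ → σ ∈ flaw i → A i σ ≢ ⁅ σ ⁆

  -- { σ ∈ fᵢ : τ ∈ A(i,σ) }
  predecessors : Fin m → Fin n → Subset n
  predecessors i τ = Vec.tabulate λ σ → does ((σ ∈? flaw i) ×-dec (τ ∈? A i σ))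

  Atomic : Set
  Atomic = ∀ i → max 0 (List.tabulate λ τ → ∣ predecessors i τ ∣) ≡ 1

module Measures {c ℓ₁ ℓ₂ ℓ₃} (K : OrderedField c ℓ₁ ℓ₂ ℓ₃) where
  open OrderedField K public hiding (zero)
  open import Algebra.Properties.Monoid.Sum
    (CommutativeRing.+-monoid commutativeRing) using (sum)

  ∑∈ : ∀ {n} → Subset n → Vector Carrier n → Carrier
  ∑∈ S t = sum λ σ → if does (σ ∈? S) then t σ else 0#

  syntax ∑∈ S (λ σ → t) = ∑[ σ ∈ S ] t

  record IsDistributionOn {n} (S : Subset n) (p : Vector Carrier n)
      : Set (ℓ₁ ⊔ ℓ₃) where
    field
      nonneg  : ∀ τ → 0# ≤ p τ
      support : ∀ τ → τ ∉ S → p τ ≈ 0#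
      total   : ∑[ τ ∈ S ] p τ ≈ 1#

  record IsProbability {n} (p : Vector Carrier n) : Set (ℓ₁ ⊔ ℓ₃) where
    field
      nonneg : ∀ τ → 0# ≤ p τ
      total  : sum p ≈ 1#

  Positive : ∀ {n} → Vector Carrier n → Set ℓ₃
  Positive μ = ∀ σ → 0# < μ σ

  private
    pos+pos : ∀ {x y} → 0# < x → 0# < y → 0# < x + y
    pos+pos {x} {y} 0<x 0<y =
      <-trans 0<y (<-respˡ-≈ (+-identityˡ y) (+-monoˡ-< y 0<x))

    pos+0 : ∀ {x y} → 0# < x → y ≈ 0# → 0# < x + y
    pos+0 {x} 0<x y≈0 =
      <-respʳ-≈ (sym (trans (+-congˡ y≈0) (+-identityʳ x))) 0<x

    0+pos : ∀ {x y} → x ≈ 0# → 0# < y → 0# < x + y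
    0+pos {x} {y} x≈0 0<y =
      <-respʳ-≈ (sym (trans (+-congʳ x≈0) (+-identityˡ y))) 0<y

    sum-0⊎pos : ∀ {n} (t : Vector Carrier n) →
                (∀ σ → t σ ≈ 0# ⊎ 0# < t σ) → sum t ≈ 0# ⊎ 0# < sum t
    sum-0⊎pos {zero}  t h = inj₁ refl
    sum-0⊎pos {suc n} t h
      with h zero | sum-0⊎pos (λ σ → t (suc σ)) (λ σ → h (suc σ))
    ... | inj₁ x≈0 | inj₁ y≈0 = inj₁ (trans (+-cong x≈0 y≈0) (+-identityˡ 0#))
    ... | inj₁ x≈0 | inj₂ 0<y = inj₂ (0+pos x≈0 0<y)
    ... | inj₂ 0<x | inj₁ y≈0 = inj₂ (pos+0 0<x y≈0)
    ... | inj₂ 0<x | inj₂ 0<y = inj₂ (pos+pos 0<x 0<y)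

    sum-pos : ∀ {n} (t : Vector Carrier n) →
              (∀ σ → t σ ≈ 0# ⊎ 0# < t σ) → ∀ σ → 0# < t σ → 0# < sum t
    sum-pos {suc n} t h zero 0<x
      with sum-0⊎pos (λ σ → t (suc σ)) (λ σ → h (suc σ))
    ... | inj₁ y≈0 = pos+0 0<x y≈0
    ... | inj₂ 0<y = pos+pos 0<x 0<y
    sum-pos {suc n} t h (suc σ) 0<tσ
      with h zero | sum-pos (λ σ → t (suc σ)) (λ σ → h (suc σ)) σ 0<tσ
    ... | inj₁ x≈0 | 0<y = 0+pos x≈0 0<y
    ... | inj₂ 0<x | 0<y = pos+pos 0<x 0<y

  ∑∈-pos : ∀ {n} {μ : Vector Carrier n} → Positive μ →
           ∀ {S} → Nonempty S → 0# < ∑∈ S μ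
  ∑∈-pos {μ = μ} μ>0 {S} (σ₀ , σ₀∈S) = sum-pos _ 0⊎pos σ₀ pos
    where
    0⊎pos : ∀ σ → let x = if does (σ ∈? S) then μ σ else 0# in x ≈ 0# ⊎ 0# < x
    0⊎pos σ with does (σ ∈? S)
    ... | true  = inj₂ (μ>0 σ)
    ... | false = inj₁ refl

    pos : 0# < (if does (σ₀ ∈? S) then μ σ₀ else 0#)
    pos with σ₀ ∈? S
    ... | yes _    = μ>0 σ₀
    ... | no σ₀∉S = contradiction σ₀∈S σ₀∉S

  module _ {n m} (D : FlawDigraph n m) where
    open FlawDigraph D

    -- ρ i σ τ is ρᵢ(σ,τ), constrained only for σ ∈ fᵢ.
    Transitions : Set c
    Transitions = Fin m → Fin n → Fin n → Carrier

    IsTransition : Transitions → Set (ℓ₁ ⊔ ℓ₃)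
    IsTransition ρ = ∀ i σ → σ ∈ flaw i → IsDistributionOn (A i σ) (ρ i σ)

    module _ {μ : Vector Carrier n} (μ>0 : Positive μ) where

      flaw#0 : ∀ i → ∑∈ (flaw i) μ # 0#
      flaw#0 i = pos⇒#0 (∑∈-pos μ>0 (flaw-nonempty i))

      A#0 : ∀ i σ → σ ∈ flaw i → ∑∈ (A i σ) μ # 0#
      A#0 i σ σ∈fᵢ = pos⇒#0 (∑∈-pos μ>0 (A-nonempty i σ σ∈fᵢ))

      RegeneratesAt : Transitions → Fin m → Set ℓ₁
      RegeneratesAt ρ i = ∀ τ →
        1# / ∑∈ (flaw i) μ ⟨ flaw#0 i ⟩ * (∑[ σ ∈ flaw i ] (μ σ * ρ i σ τ)) ≈ μ τ

      Harmonic : Transitions → Set ℓ₁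
      Harmonic ρ = ∀ i σ (σ∈fᵢ : σ ∈ flaw i) τ → τ ∈ A i σ →
        ρ i σ τ ≈ μ τ / (∑[ σ′ ∈ A i σ ] μ σ′) ⟨ A#0 i σ σ∈fᵢ ⟩

{-# OPTIONS --safe #-}

-- Atomicity leaves at most one σ ∈ fᵢ with an arc to a given τ, so for τ ∈ A(i,σ)
-- the regeneration equation collapses to (μ(σ)/μ(fᵢ)) ρᵢ(σ,τ) = μ(τ). Summing over
-- τ ∈ A(i,σ) gives the value of μ(A(i,σ)), and substituting it back gives harmonicity.
module Submission where

open import Defs
open import Algebra.Bundles using (CommutativeRing)
import Algebra.Apartness.Properties.HeytingCommutativeRing as HeytingProperties
import Algebra.Properties.CommutativeSemigroup as CommutativeSemigroupProperties
import Algebra.Properties.Semiring.Sum as SemiringSum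
open import Data.Bool.Base using (if_then_else_)
open import Data.Fin.Base using (punchIn)
open import Data.Fin.Properties using (_≟_; punchInᵢ≢i)
open import Data.Fin.Subset using (Subset; ⁅_⁆; _∈_; ∣_∣)
open import Data.Fin.Subset.Properties
  using (_∈?_; ∣⁅x⁆∣≡1; p⊂q⇒∣p∣<∣q∣; x∈⁅y⁆⇒x≡y; x≢y⇒x∉⁅y⁆)
open import Data.List.Base as List using ()
open import Data.List.Extrema.Nat using (xs≤max)
open import Data.List.Relation.Unary.All.Properties using (tabulate⁻)
open import Data.Nat.Base using (suc; _≤_; _<_)
open import Data.Nat.Properties using (<⇒≱)
open import Data.Product.Base using (_×_; _,_; proj₁; proj₂)
open import Data.Vec.Functional using (Vector)
open import Data.Vec.Properties using (lookup⇒[]=; lookup∘tabulate)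
open import Relation.Binary.PropositionalEquality as ≡ using (_≡_; _≢_)
import Relation.Binary.Reasoning.Setoid as SetoidReasoning
open import Relation.Nullary.Decidable
  using (yes; no; does; dec-true; _×-dec_; decidable-stable)
open import Relation.Nullary.Negation using (contradiction)

-- If `x` differed from `y`, then `⁅ y ⁆` would be a proper subset of `p`, missing `x`, and `p`
-- would have more than one element. Equality on `Fin n` is decidable, so refuting `x ≢ y` suffices.
∣p∣≤1⇒x≡y : ∀ {n} {p : Subset n} {x y} → ∣ p ∣ ≤ 1 → x ∈ p → y ∈ p → x ≡ y
∣p∣≤1⇒x≡y {p = p} {x} {y} ∣p∣≤1 x∈p y∈p = decidable-stable (x ≟ y) λ x≢y →
  <⇒≱ (≡.subst (_< ∣ p ∣) (∣⁅x⁆∣≡1 y)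
        (p⊂q⇒∣p∣<∣q∣ (⁅y⁆⊆p , x , x∈p , x≢y⇒x∉⁅y⁆ x≢y)))
      ∣p∣≤1
  where
  ⁅y⁆⊆p : ∀ {z} → z ∈ ⁅ y ⁆ → z ∈ p
  ⁅y⁆⊆p z∈⁅y⁆ = ≡.subst (_∈ p) (≡.sym (x∈⁅y⁆⇒x≡y y z∈⁅y⁆)) y∈p

module _ {n m} (D : FlawDigraph n m) where
  open FlawDigraph D

  -- The subset is a tabulated Boolean vector, so membership means that its entry at `σ` is `true`;
  -- the two hypotheses settle that decision.
  ∈-predecessors : ∀ {i σ τ} → σ ∈ flaw i → τ ∈ A i σ → σ ∈ predecessors i τ
  ∈-predecessors {i} {σ} {τ} σ∈fᵢ τ∈A = lookup⇒[]= σ _ (≡.trans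
    (lookup∘tabulate _ σ)
    (dec-true ((σ ∈? flaw i) ×-dec (τ ∈? A i σ)) (σ∈fᵢ , τ∈A)))

  atomic⇒unique-predecessor : Atomic → ∀ {i σ σ′ τ} → σ ∈ flaw i → σ′ ∈ flaw i →
                              τ ∈ A i σ → τ ∈ A i σ′ → σ ≡ σ′
  atomic⇒unique-predecessor atomic {i} {τ = τ} σ∈fᵢ σ′∈fᵢ τ∈Aσ τ∈Aσ′ =
    ∣p∣≤1⇒x≡y ∣pred∣≤1 (∈-predecessors σ∈fᵢ τ∈Aσ) (∈-predecessors σ′∈fᵢ τ∈Aσ′)
    where
    sizes = List.tabulate λ τ → ∣ predecessors i τ ∣

    ∣pred∣≤1 : ∣ predecessors i τ ∣ ≤ 1
    -- The maximum, taken with default 0, bounds the count at every `τ`, and atomicity fixes it at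
    -- 1.
    ∣pred∣≤1 = ≡.subst (∣ predecessors i τ ∣ ≤_) (atomic i)
                 (tabulate⁻ (xs≤max 0 sizes) τ)

module _ {c ℓ₁ ℓ₂ ℓ₃} (K : OrderedField c ℓ₁ ℓ₂ ℓ₃) where
  open Measures K hiding (_≤_; _<_)
  open CommutativeRing commutativeRing using (semiring; *-commutativeSemigroup)
  open HeytingProperties heytingCommutativeRing using (x-0≈x)
  open SemiringSum semiring
    using (sum; sum-cong-≋; sum-remove; sum-replicate-zero; *-distribˡ-sum)
  open CommutativeSemigroupProperties *-commutativeSemigroup using (x∙yz≈yx∙z)
  open SetoidReasoning setoid

  x*y≈z⇒x≈z/y : ∀ {x y z} (y#0 : y # 0#) → x * y ≈ z → x ≈ z / y ⟨ y#0 ⟩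
  x*y≈z⇒x≈z/y {x} {y} {z} y#0 xy≈z = begin
    x                     ≈⟨ *-identityʳ x ⟨
    -- Apartness from `0#` supplies an inverse of the difference `y - 0#`, so `1#` is expanded with
    -- that difference and the `0#` is dropped afterwards.
    x * 1#                ≈⟨ *-congˡ (proj₂ (proj₂ (#⇒invertible y#0))) ⟨
    x * ((y - 0#) * y⁻¹)  ≈⟨ *-congˡ (*-congʳ (x-0≈x y)) ⟩
    x * (y * y⁻¹)         ≈⟨ *-assoc x y y⁻¹ ⟨
    x * y * y⁻¹           ≈⟨ *-congʳ xy≈z ⟩
    z * y⁻¹               ∎
    where
    y⁻¹ = proj₁ (#⇒invertible y#0)

  -- Once the entry at `σ` is split off, the others are indexed through `punchIn σ`, which never
  -- takes the value `σ`.
  sum-single : ∀ {n} (t : Vector Carrier n) σ → (∀ σ′ → σ′ ≢ σ → t σ′ ≈ 0#) → sum t ≈ t σ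
  sum-single {suc n} t σ t≈0 = begin
    sum t                              ≈⟨ sum-remove t ⟩
    t σ + sum (λ j → t (punchIn σ j))  ≈⟨ +-congˡ (sum-cong-≋ rest≈0) ⟩
    t σ + sum {n} (λ _ → 0#)           ≈⟨ +-congˡ (sum-replicate-zero n) ⟩
    t σ + 0#                           ≈⟨ +-identityʳ (t σ) ⟩
    t σ                                ∎
    where
    rest≈0 : ∀ j → t (punchIn σ j) ≈ 0#
    rest≈0 j = t≈0 (punchIn σ j) (punchInᵢ≢i σ j)

  -- Agreement is asked only on `S`, because the flow identity is available only for `τ ∈ A i σ`.
  ∑∈-cong : ∀ {n} (S : Subset n) {f g : Vector Carrier n} →
            (∀ σ → σ ∈ S → f σ ≈ g σ) → ∑∈ S f ≈ ∑∈ S g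
  ∑∈-cong S {f} {g} f≈g = sum-cong-≋ term
    where
    term : ∀ σ → (if does (σ ∈? S) then f σ else 0#) ≈
               (if does (σ ∈? S) then g σ else 0#)
    term σ with σ ∈? S
    ... | yes σ∈S = f≈g σ σ∈S
    ... | no  _   = refl

  *-distribˡ-∑∈ : ∀ {n} (S : Subset n) x (f : Vector Carrier n) →
                  x * ∑∈ S f ≈ ∑[ σ ∈ S ] (x * f σ)
  *-distribˡ-∑∈ S x f =
    trans (*-distribˡ-sum x (λ σ → if does (σ ∈? S) then f σ else 0#)) (sum-cong-≋ term)
    where
    term : ∀ σ → x * (if does (σ ∈? S) then f σ else 0#) ≈
               (if does (σ ∈? S) then x * f σ else 0#)
    term σ with σ ∈? S
    ... | yes _ = refl
    ... | no  _ = zeroʳ x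

  ∑∈-single : ∀ {n} {S : Subset n} {f : Vector Carrier n} {σ} → σ ∈ S →
              (∀ σ′ → σ′ ∈ S → σ′ ≢ σ → f σ′ ≈ 0#) → ∑∈ S f ≈ f σ
  ∑∈-single {S = S} {f} {σ} σ∈S f≈0 = trans (sum-single _ σ off) on
    where
    off : ∀ σ′ → σ′ ≢ σ → (if does (σ′ ∈? S) then f σ′ else 0#) ≈ 0#
    off σ′ σ′≢σ with σ′ ∈? S
    ... | yes σ′∈S = f≈0 σ′ σ′∈S σ′≢σ
    ... | no  _    = refl

    on : (if does (σ ∈? S) then f σ else 0#) ≈ f σ
    on with σ ∈? S
    ... | yes _   = refl
    ... | no σ∉S = contradiction σ∈S σ∉S

  module _ {n m} (D : FlawDigraph n m) (ρ : Transitions D) (ρ-trans : IsTransition D ρ)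
           {μ : Vector Carrier n} (μ>0 : Positive μ) (atomic : FlawDigraph.Atomic D) where
    open FlawDigraph D

    regenerates⇒flow : ∀ {i} → RegeneratesAt D μ>0 ρ i → ∀ {σ τ} → σ ∈ flaw i → τ ∈ A i σ →
                       (μ σ / ∑∈ (flaw i) μ ⟨ flaw#0 D μ>0 i ⟩) * ρ i σ τ ≈ μ τ
    regenerates⇒flow {i} regen {σ} {τ} σ∈fᵢ τ∈A = begin
      (μ σ * F⁻¹) * ρ i σ τ                           ≈⟨ x∙yz≈yx∙z F⁻¹ (μ σ) (ρ i σ τ) ⟨
      -- Read from right to left: the quotient in `RegeneratesAt` unfolds to `1# * F⁻¹`, and only
      -- the term of `σ` survives in the sum.
      F⁻¹ * (μ σ * ρ i σ τ)                           ≈⟨ *-cong (*-identityˡ F⁻¹) (∑∈-single σ∈fᵢ no-flow) ⟨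
      1# * F⁻¹ * (∑[ σ′ ∈ flaw i ] (μ σ′ * ρ i σ′ τ)) ≈⟨ regen τ ⟩
      μ τ                                             ∎
      where
      F⁻¹ = proj₁ (#⇒invertible (flaw#0 D μ>0 i))

      no-flow : ∀ σ′ → σ′ ∈ flaw i → σ′ ≢ σ → μ σ′ * ρ i σ′ τ ≈ 0#
      -- An arc from `σ′` to `τ` would force `σ′ ≡ σ`, so `τ` lies outside the support of `ρ i σ′`.
      no-flow σ′ σ′∈fᵢ σ′≢σ = trans
        (*-congˡ (IsDistributionOn.support (ρ-trans i σ′ σ′∈fᵢ) τ λ τ∈A′ →
          σ′≢σ (atomic⇒unique-predecessor D atomic σ′∈fᵢ σ∈fᵢ τ∈A′ τ∈A)))
        (zeroʳ (μ σ′))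

    regenerates⇒∑A : ∀ {i} → RegeneratesAt D μ>0 ρ i → ∀ {σ} → σ ∈ flaw i →
                     (∑[ τ ∈ A i σ ] μ τ) ≈ μ σ / ∑∈ (flaw i) μ ⟨ flaw#0 D μ>0 i ⟩
    regenerates⇒∑A {i} regen {σ} σ∈fᵢ = begin
      -- The factor `q` does not depend on `τ`, so it leaves the sum, and what remains is the total
      -- mass of `ρ i σ`.
      (∑[ τ ∈ A i σ ] μ τ)            ≈⟨ ∑∈-cong (A i σ) (λ _ → regenerates⇒flow regen σ∈fᵢ) ⟨
      (∑[ τ ∈ A i σ ] (q * ρ i σ τ))  ≈⟨ *-distribˡ-∑∈ (A i σ) q (ρ i σ) ⟨
      q * ∑∈ (A i σ) (ρ i σ)          ≈⟨ *-congˡ (IsDistributionOn.total (ρ-trans i σ σ∈fᵢ)) ⟩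
      q * 1#                          ≈⟨ *-identityʳ q ⟩
      q                               ∎
      where
      q = μ σ / ∑∈ (flaw i) μ ⟨ flaw#0 D μ>0 i ⟩

    -- After clearing the denominator and replacing `∑∈ (A i σ) μ` by `q`, the claim is the flow
    -- identity itself.
    regenerates⇒harmonic : (∀ i → RegeneratesAt D μ>0 ρ i) → Harmonic D μ>0 ρ
    regenerates⇒harmonic regen i σ σ∈fᵢ τ τ∈A = x*y≈z⇒x≈z/y (A#0 D μ>0 i σ σ∈fᵢ) (begin
      ρ i σ τ * ∑∈ (A i σ) μ  ≈⟨ *-congˡ (regenerates⇒∑A (regen i) σ∈fᵢ) ⟩
      ρ i σ τ * q             ≈⟨ *-comm (ρ i σ τ) q ⟩
      q * ρ i σ τ             ≈⟨ regenerates⇒flow (regen i) σ∈fᵢ τ∈A ⟩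
      μ τ                     ∎)
      where
      q = μ σ / ∑∈ (flaw i) μ ⟨ flaw#0 D μ>0 i ⟩

theorem6 : ∀ {c ℓ₁ ℓ₂ ℓ₃} (K : OrderedField c ℓ₁ ℓ₂ ℓ₃) → let open Measures K in
    ∀ {n m} (D : FlawDigraph n m) → let open FlawDigraph D in
    (ρ : Transitions D) → IsTransition D ρ →
    (μ : Vector Carrier n) → IsProbability μ → (μ>0 : Positive μ) →
    Atomic → (∀ i → RegeneratesAt D μ>0 ρ i) →
    Harmonic D μ>0 ρ ×
    (∀ i σ → σ ∈ flaw i → (∑[ τ ∈ A i σ ] μ τ) ≈ μ σ / ∑∈ (flaw i) μ ⟨ flaw#0 D μ>0 i ⟩)
theorem6 K D ρ ρ-trans μ _ μ>0 atomic regen =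
  regenerates⇒harmonic K D ρ ρ-trans μ>0 atomic regen ,
  λ i σ → regenerates⇒∑A K D ρ ρ-trans μ>0 atomic (regen i)
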